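{- Let $(\mathcal{P},\mathcal{S},\times,\preceq)$ be an $\alpha$-many-one category extension with $\alpha\ge 2$. Then the partially ordered class $\mathfrak{D}(\mathcal{P},\mathcal{S},\times,\preceq)$ of $\leq_m$-equivalence classes of morphisms of $\mathcal{P}$, ordered by $\leq_m$, is a distributive lattice.
   Context: Notation. For a morphism $f:A\to B$ write $\mathrm{Dom}(f)=A$, $\mathrm{CDom}(f)=B$; $f\in\mathcal{P}$ means $f$ is a morphism of $\mathcal{P}$. p-category: a category $\mathcal{C}$ with a naturally associative and naturally commutative bifunctor $\times:\mathcal{C}\times\mathcal{C}\to\mathcal{C}$ (not necessarily the categorical product; associativity and commutativity isomorphisms are the canonical ones, compatible with projections and diagonals), a natural transformation $\Delta_X:X\to X\times X$, and projections $\pi_1^{X,Y}:X\times Y\to X$ (natural in $X$ for each fixed $Y$) and $\pi_2^{X,Y}:X\times Y\to Y$ (natural in $Y$ for each fixed $X$), such that $\pi_1^{X,X}\circ\Delta_X=\pi_2^{X,X}\circ\Delta_X=\mathrm{id}_X$; $(\pi_1^{X,Y}\times\pi_2^{X,Y})\circ\Delta_{X\times Y}=\mathrm{id}_{X\times Y}$; $\pi_1^{X,Y}\circ(\mathrm{id}_X\times\pi_1^{Y,Z})=\pi_1^{X,Y\times Z}=\pi_1^{X,Z}\circ(\mathrm{id}_X\times\pi_2^{Y,Z})$; $\pi_2^{X,Z}\circ(\pi_1^{X,Y}\times\mathrm{id}_Z)=\pi_2^{X\times Y,Z}=\pi_2^{Y,Z}\circ(\pi_2^{X,Y}\times\mathrm{id}_Z)$.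 For $f:A\to B$ put $\mathrm{dom}(f)=\pi_1^{A,B}\circ(\mathrm{id}_A\times f)\circ\Delta_A:A\to A$ (such morphisms are called domains). For domains on the same object, $\mathrm{dom}(f)\subseteq\mathrm{dom}(g)$ means $\mathrm{dom}(f)\circ\mathrm{dom}(g)=\mathrm{dom}(f)$. Poset enriched p-category: a p-category with a preorder $\preceq$ on each hom-set such that (1) $f_1\preceq f_2$ implies $g\circ f_1\circ h\preceq g\circ f_2\circ h$; (2) $f_1\preceq f_2$ implies $f_1\times g\preceq f_2\times g$; (3) $f_\nu\preceq g_\nu$ for all $\nu<\alpha$ implies $\coprod_{\nu<\alpha}f_\nu\preceq\coprod_{\nu<\alpha}g_\nu$ whenever these coproducts exist; (4) $\mathrm{dom}(f)\subseteq\mathrm{dom}(g)\subseteq\mathrm{dom}(h)$ and $\mathrm{dom}(h)\preceq\mathrm{dom}(f)$ imply $\mathrm{dom}(h)\preceq\mathrm{dom}(g)$. It is meet-semilattice enriched if moreover binary infima exist for $\preceq$ on each hom-set and (5) $g\circ\inf\{f_1,f_2\}\circ h=\inf\{g\circ f_1\circ h,\,g\circ f_2\circ h\}$; (6) $g\times\inf\{f_1,f_2\}=\inf\{g\times f_1,g\times f_2\}$; (7) $\inf\{\coprod_{\nu<\alpha}f_\nu,\coprod_{\nu<\alpha}g_\nu\}=\coprod_{\nu<\alpha}\inf\{f_\nu,g_\nu\}$ whenever these coproducts exist. (As $\preceq$ is a preorder, infima and these identities are understood up to $\preceq$-equivalence.) Distributive coproducts of size $\alpha$: all coproducts of families indexed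 by $\nu<\alpha$ exist, and there is a natural (canonical, i.e. $a\circ(\mathrm{id}_A\times\iota_\mu)=\iota_\mu$) isomorphism $a:A\times\coprod_{\nu<\alpha}B_\nu\to\coprod_{\nu<\alpha}(A\times B_\nu)$. Totally connected: for all objects $A,B$ there is a morphism $c_{A,B}:A\to B$, with $c_{A,A}=\mathrm{id}_A$. $\alpha$-many-one category extension ($\alpha$-moce) $(\mathcal{P},\mathcal{S},\times,\preceq)$: a category $\mathcal{P}$ with a wide subcategory $\mathcal{S}$ (same objects) such that $\mathcal{P}$ is a meet-semilattice enriched p-category (with $\times$, $\preceq$) with distributive coproducts of every (nonzero) size up to $\alpha$; $\mathcal{S}$ is closed under $\times$ and is a p-category with the restricted structure (so contains diagonals and projections), contains all domains of $\mathcal{P}$, is closed under the coproducts of $\mathcal{P}$ (so contains coproduct injections and codiagonals, and coproducts of $\mathcal{P}$ are coproducts in $\mathcal{S}$), contains the canonical distributivity isomorphisms, and is totally connected. Many-one reduction: for $f,g\in\mathcal{P}$, $f\leq_m g$ iff there are $H,K\in\mathcal{S}$ with $f\preceq H\circ(\mathrm{id}_{\mathrm{Dom}(f)}\times(g\circ K))\circ\Delta_{\mathrm{Dom}(f)}$. This is a preorder; $\mathfrak{D}(\mathcal{P},\mathcal{S},\times,\preceq)$ is the partially ordered class of its equivalence classes. -}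

module Defs where

open import Level using (Level; suc; _⊔_)
open import Data.Product using (Σ-syntax; ∃-syntax; _×_; _,_)
open import Function.Bundles using (_↣_)
open import Relation.Binary.Core using (Rel)
open import Relation.Binary.Structures using (IsEquivalence; IsPreorder)
open import Relation.Binary.Lattice.Definitions using (Infimum)
open import Relation.Binary.Construct.Interior.Symmetric using (SymInterior)

-- Hom-sets are setoids: _≈_ is equality of morphisms.
record Category (o ℓ e : Level) : Set (suc (o ⊔ ℓ ⊔ e)) where
  infix  4 _≈_ _⇒_
  infixr 9 _∘_
  field
    Obj       : Set o
    _⇒_       : Obj → Obj → Set ℓ
    _≈_       : ∀ {A B} → Rel (A ⇒ B) e
    id        : ∀ {A} → A ⇒ A
    _∘_       : ∀ {A B C} → B ⇒ C → A ⇒ B → A ⇒ C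
    equiv     : ∀ {A B} → IsEquivalence (_≈_ {A} {B})
    assoc     : ∀ {A B C D} {f : A ⇒ B} {g : B ⇒ C} {h : C ⇒ D} →
                (h ∘ g) ∘ f ≈ h ∘ (g ∘ f)
    identityˡ : ∀ {A B} {f : A ⇒ B} → id ∘ f ≈ f
    identityʳ : ∀ {A B} {f : A ⇒ B} → f ∘ id ≈ f
    ∘-resp-≈  : ∀ {A B C} {f h : B ⇒ C} {g i : A ⇒ B} →
                f ≈ h → g ≈ i → f ∘ g ≈ h ∘ i

  record Coproduct {c} {J : Set c} (B : J → Obj) : Set (o ⊔ ℓ ⊔ e ⊔ c) where
    field
      ∐B       : Obj
      ι        : ∀ j → B j ⇒ ∐B
      copair   : ∀ {X} → (∀ j → B j ⇒ X) → ∐B ⇒ X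
      copair-ι : ∀ {X} (f : ∀ j → B j ⇒ X) j → copair f ∘ ι j ≈ f j
      unique   : ∀ {X} (f : ∀ j → B j ⇒ X) (h : ∐B ⇒ X) →
                 (∀ j → h ∘ ι j ≈ f j) → h ≈ copair f

  open Coproduct public using (∐B)

  ∐-map : ∀ {c} {J : Set c} {A B : J → Obj} (P : Coproduct A) (Q : Coproduct B) →
          (∀ j → A j ⇒ B j) → ∐B P ⇒ ∐B Q
  ∐-map P Q f = Coproduct.copair P (λ j → Coproduct.ι Q j ∘ f j)

record PCategory (o ℓ e : Level) : Set (suc (o ⊔ ℓ ⊔ e)) where
  field
    category : Category o ℓ e
  open Category category public

  infixr 10 _⊗₀_ _⊗₁_
  field
    -- Not assumed to be the categorical product.
    _⊗₀_     : Obj → Obj → Obj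
    _⊗₁_     : ∀ {A B C D} → A ⇒ B → C ⇒ D → A ⊗₀ C ⇒ B ⊗₀ D
    ⊗-resp-≈ : ∀ {A B C D} {f f′ : A ⇒ B} {g g′ : C ⇒ D} →
               f ≈ f′ → g ≈ g′ → f ⊗₁ g ≈ f′ ⊗₁ g′
    ⊗-id     : ∀ {A B} → id {A} ⊗₁ id {B} ≈ id
    ⊗-∘      : ∀ {A B C A′ B′ C′} {f : A ⇒ B} {g : B ⇒ C} {f′ : A′ ⇒ B′} {g′ : B′ ⇒ C′} →
               (g ∘ f) ⊗₁ (g′ ∘ f′) ≈ (g ⊗₁ g′) ∘ (f ⊗₁ f′)

    Δ  : ∀ {X} → X ⇒ X ⊗₀ X
    π₁ : ∀ {X Y} → X ⊗₀ Y ⇒ X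
    π₂ : ∀ {X Y} → X ⊗₀ Y ⇒ Y

    -- Each projection is natural in one argument only: morphisms may be partial.
    Δ-natural  : ∀ {X Y} (f : X ⇒ Y) → Δ ∘ f ≈ (f ⊗₁ f) ∘ Δ
    π₁-natural : ∀ {X X′ Y} (f : X ⇒ X′) → π₁ ∘ (f ⊗₁ id {Y}) ≈ f ∘ π₁
    π₂-natural : ∀ {X Y Y′} (f : Y ⇒ Y′) → π₂ ∘ (id {X} ⊗₁ f) ≈ f ∘ π₂

    π₁-Δ     : ∀ {X} → π₁ ∘ Δ {X} ≈ id
    π₂-Δ     : ∀ {X} → π₂ ∘ Δ {X} ≈ id
    π₁⊗π₂-Δ  : ∀ {X Y} → (π₁ ⊗₁ π₂) ∘ Δ {X ⊗₀ Y} ≈ id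
    π₁-id⊗π₁ : ∀ {X Y Z} → π₁ ∘ (id {X} ⊗₁ π₁ {Y} {Z}) ≈ π₁
    π₁-id⊗π₂ : ∀ {X Y Z} → π₁ ∘ (id {X} ⊗₁ π₂ {Y} {Z}) ≈ π₁
    π₂-π₁⊗id : ∀ {X Y Z} → π₂ ∘ (π₁ {X} {Y} ⊗₁ id {Z}) ≈ π₂
    π₂-π₂⊗id : ∀ {X Y Z} → π₂ ∘ (π₂ {X} {Y} ⊗₁ id {Z}) ≈ π₂

    swap         : ∀ {X Y} → X ⊗₀ Y ⇒ Y ⊗₀ X
    swap-swap    : ∀ {X Y} → swap ∘ swap {X} {Y} ≈ id
    swap-natural : ∀ {X X′ Y Y′} (f : X ⇒ X′) (g : Y ⇒ Y′) →
                   swap ∘ (f ⊗₁ g) ≈ (g ⊗₁ f) ∘ swap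

    α⇒           : ∀ {X Y Z} → X ⊗₀ (Y ⊗₀ Z) ⇒ (X ⊗₀ Y) ⊗₀ Z
    α⇐           : ∀ {X Y Z} → (X ⊗₀ Y) ⊗₀ Z ⇒ X ⊗₀ (Y ⊗₀ Z)
    α⇒-α⇐        : ∀ {X Y Z} → α⇒ ∘ α⇐ {X} {Y} {Z} ≈ id
    α⇐-α⇒        : ∀ {X Y Z} → α⇐ ∘ α⇒ {X} {Y} {Z} ≈ id
    α⇒-natural   : ∀ {X X′ Y Y′ Z Z′} (f : X ⇒ X′) (g : Y ⇒ Y′) (h : Z ⇒ Z′) →
                   α⇒ ∘ (f ⊗₁ (g ⊗₁ h)) ≈ ((f ⊗₁ g) ⊗₁ h) ∘ α⇒

    -- swap and α⇒ are the canonical isomorphisms.  A morphism h into X ⊗₀ Y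
    -- equals ((π₁ ∘ h) ⊗₁ (π₂ ∘ h)) ∘ Δ, so the equations with projections
    -- determine both of them.
    π₁-swap : ∀ {X Y} → π₁ ∘ swap {X} {Y} ≈ π₂
    π₂-swap : ∀ {X Y} → π₂ ∘ swap {X} {Y} ≈ π₁
    swap-Δ  : ∀ {X} → swap ∘ Δ {X} ≈ Δ
    π₁-α⇒   : ∀ {X Y Z} → π₁ ∘ α⇒ {X} {Y} {Z} ≈ id ⊗₁ π₁
    π₂-α⇒   : ∀ {X Y Z} → π₂ ∘ α⇒ {X} {Y} {Z} ≈ π₂ ∘ π₂
    α⇒-Δ    : ∀ {X} → α⇒ ∘ (id ⊗₁ Δ) ∘ Δ {X} ≈ (Δ ⊗₁ id) ∘ Δ

  dom : ∀ {A B} → A ⇒ B → A ⇒ A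
  dom f = π₁ ∘ (id ⊗₁ f) ∘ Δ

  infix 4 _⊆_
  _⊆_ : ∀ {A} → Rel (A ⇒ A) e
  d ⊆ d′ = d ∘ d′ ≈ d

  record DistributiveCoproducts {c} (J : Set c) : Set (o ⊔ ℓ ⊔ e ⊔ c) where
    field
      coproduct : (B : J → Obj) → Coproduct B

    ∐ : (J → Obj) → Obj
    ∐ B = ∐B (coproduct B)

    ι : ∀ {B : J → Obj} j → B j ⇒ ∐ B
    ι {B} = Coproduct.ι (coproduct B)

    copair : ∀ {B : J → Obj} {X} → (∀ j → B j ⇒ X) → ∐ B ⇒ X
    copair {B} = Coproduct.copair (coproduct B)

    ∐₁ : ∀ {A B : J → Obj} → (∀ j → A j ⇒ B j) → ∐ A ⇒ ∐ B
    ∐₁ {A} {B} = ∐-map (coproduct A) (coproduct B)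

    field
      distrib         : ∀ {A} {B : J → Obj} → A ⊗₀ ∐ B ⇒ ∐ (λ j → A ⊗₀ B j)
      distrib⁻¹       : ∀ {A} {B : J → Obj} → ∐ (λ j → A ⊗₀ B j) ⇒ A ⊗₀ ∐ B
      distrib-invˡ    : ∀ {A} {B : J → Obj} → distrib⁻¹ {A} {B} ∘ distrib ≈ id
      distrib-invʳ    : ∀ {A} {B : J → Obj} → distrib {A} {B} ∘ distrib⁻¹ ≈ id
      distrib-ι       : ∀ {A} {B : J → Obj} j → distrib {A} {B} ∘ (id ⊗₁ ι j) ≈ ι j
      distrib-natural : ∀ {A A′} {B B′ : J → Obj} (f : A ⇒ A′) (g : ∀ j → B j ⇒ B′ j) →
                        distrib ∘ (f ⊗₁ ∐₁ g) ≈ ∐₁ (λ j → f ⊗₁ g j) ∘ distrib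

record PosetEnrichedPCategory (o ℓ e p c : Level) : Set (suc (o ⊔ ℓ ⊔ e ⊔ p ⊔ c)) where
  field
    pCategory : PCategory o ℓ e
  open PCategory pCategory public

  infix 4 _⪯_
  field
    _⪯_        : ∀ {A B} → Rel (A ⇒ B) p
    isPreorder : ∀ {A B} → IsPreorder (_≈_ {A} {B}) _⪯_

    ∘-mono : ∀ {A B C D} {f₁ f₂ : B ⇒ C} (g : C ⇒ D) (h : A ⇒ B) →
             f₁ ⪯ f₂ → g ∘ f₁ ∘ h ⪯ g ∘ f₂ ∘ h
    ⊗-mono : ∀ {A B C D} {f₁ f₂ : A ⇒ B} (g : C ⇒ D) →
             f₁ ⪯ f₂ → f₁ ⊗₁ g ⪯ f₂ ⊗₁ g
    ∐-mono : ∀ {J : Set c} {A B : J → Obj} (P : Coproduct A) (Q : Coproduct B)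
             {f g : ∀ j → A j ⇒ B j} →
             (∀ j → f j ⪯ g j) → ∐-map P Q f ⪯ ∐-map P Q g
    dom-⪯  : ∀ {A B C D} (f : A ⇒ B) (g : A ⇒ C) (h : A ⇒ D) →
             dom f ⊆ dom g → dom g ⊆ dom h → dom h ⪯ dom f → dom h ⪯ dom g

  -- Infima for a preorder are determined only up to this equivalence.
  infix 4 _≃_
  _≃_ : ∀ {A B} → Rel (A ⇒ B) p
  _≃_ = SymInterior _⪯_

record MeetSemilatticeEnrichedPCategory (o ℓ e p c : Level)
       : Set (suc (o ⊔ ℓ ⊔ e ⊔ p ⊔ c)) where
  field
    posetEnriched : PosetEnrichedPCategory o ℓ e p c
  open PosetEnrichedPCategory posetEnriched public

  field
    inf         : ∀ {A B} → A ⇒ B → A ⇒ B → A ⇒ B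
    inf-infimum : ∀ {A B} → Infimum (_⪯_ {A} {B}) inf

    ∘-inf : ∀ {A B C D} (g : C ⇒ D) (f₁ f₂ : B ⇒ C) (h : A ⇒ B) →
            g ∘ inf f₁ f₂ ∘ h ≃ inf (g ∘ f₁ ∘ h) (g ∘ f₂ ∘ h)
    ⊗-inf : ∀ {A B C D} (g : C ⇒ D) (f₁ f₂ : A ⇒ B) →
            g ⊗₁ inf f₁ f₂ ≃ inf (g ⊗₁ f₁) (g ⊗₁ f₂)
    ∐-inf : ∀ {J : Set c} {A B : J → Obj} (P : Coproduct A) (Q : Coproduct B)
            (f g : ∀ j → A j ⇒ B j) →
            inf (∐-map P Q f) (∐-map P Q g) ≃ ∐-map P Q (λ j → inf (f j) (g j))

-- Cardinals are represented by types, and β ≤ α by an injection β ↣ α.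
record NonzeroSizeUpTo {c} (α : Set c) : Set (suc c) where
  field
    Index   : Set c
    element : Index
    inject  : Index ↣ α

record ManyOneCategoryExtension (o ℓ e p s : Level) {c : Level} (α : Set c)
       : Set (suc (o ⊔ ℓ ⊔ e ⊔ p ⊔ s ⊔ c)) where
  field
    𝒫 : MeetSemilatticeEnrichedPCategory o ℓ e p c
  open MeetSemilatticeEnrichedPCategory 𝒫 public
  open NonzeroSizeUpTo public

  field
    distributiveCoproducts : (β : NonzeroSizeUpTo α) → DistributiveCoproducts (Index β)

  module ∐[_] (β : NonzeroSizeUpTo α) =
    DistributiveCoproducts (distributiveCoproducts β)

  field
    -- The wide subcategory 𝒮, as a predicate on the morphisms of 𝒫.
    𝒮        : ∀ {A B} → A ⇒ B → Set s
    𝒮-resp-≈ : ∀ {A B} {f g : A ⇒ B} → f ≈ g → 𝒮 f → 𝒮 g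
    𝒮-id     : ∀ {A} → 𝒮 (id {A})
    𝒮-∘      : ∀ {A B C} {g : B ⇒ C} {f : A ⇒ B} → 𝒮 g → 𝒮 f → 𝒮 (g ∘ f)

    -- The equations of a p-category are inherited from 𝒫.
    𝒮-⊗    : ∀ {A B C D} {f : A ⇒ B} {g : C ⇒ D} → 𝒮 f → 𝒮 g → 𝒮 (f ⊗₁ g)
    𝒮-Δ    : ∀ {X} → 𝒮 (Δ {X})
    𝒮-π₁   : ∀ {X Y} → 𝒮 (π₁ {X} {Y})
    𝒮-π₂   : ∀ {X Y} → 𝒮 (π₂ {X} {Y})
    𝒮-swap : ∀ {X Y} → 𝒮 (swap {X} {Y})
    𝒮-α⇒   : ∀ {X Y Z} → 𝒮 (α⇒ {X} {Y} {Z})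
    𝒮-α⇐   : ∀ {X Y Z} → 𝒮 (α⇐ {X} {Y} {Z})

    𝒮-dom : ∀ {A B} (f : A ⇒ B) → 𝒮 (dom f)

    -- Coproducts of 𝒫 are coproducts in 𝒮.
    𝒮-ι      : ∀ β {B : Index β → Obj} j → 𝒮 (∐[_].ι β {B} j)
    𝒮-copair : ∀ β {B : Index β → Obj} {X} {f : ∀ j → B j ⇒ X} →
               (∀ j → 𝒮 (f j)) → 𝒮 (∐[_].copair β f)

    𝒮-distrib   : ∀ β {A} {B : Index β → Obj} → 𝒮 (∐[_].distrib β {A} {B})
    𝒮-distrib⁻¹ : ∀ β {A} {B : Index β → Obj} → 𝒮 (∐[_].distrib⁻¹ β {A} {B})

    connect      : ∀ A B → A ⇒ B
    connect-self : ∀ A → connect A A ≈ id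
    𝒮-connect    : ∀ A B → 𝒮 (connect A B)

  Morphism : Set (o ⊔ ℓ)
  Morphism = Σ[ A ∈ Obj ] Σ[ B ∈ Obj ] (A ⇒ B)

  infix 4 _≤ₘ_ _≡ₘ_
  _≤ₘ_ : Rel Morphism (ℓ ⊔ p ⊔ s)
  (A , B , f) ≤ₘ (C , D , g) =
    ∃[ H ] ∃[ K ] 𝒮 {A ⊗₀ D} {B} H × 𝒮 {A} {C} K × (f ⪯ H ∘ (id ⊗₁ (g ∘ K)) ∘ Δ)

  -- The partially ordered class 𝔇 of the extension is the setoid of morphisms
  -- under _≡ₘ_, ordered by _≤ₘ_.
  _≡ₘ_ : Rel Morphism (ℓ ⊔ p ⊔ s)
  _≡ₘ_ = SymInterior _≤ₘ_

{-# OPTIONS --safe #-}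
module Submission where

open import Defs
open import Level using (Level; Lift; lift; lower)
open import Data.Fin using (Fin; zero; suc)
open import Data.Product using (∃₂; _,_; proj₁; proj₂)
open import Function.Bundles using (_↣_; mk↣)
open import Function.Construct.Composition using (_↣-∘_)
open import Relation.Binary.Bundles using (Setoid; Preorder)
open import Relation.Binary.Definitions using (Reflexive; Transitive)
open import Relation.Binary.Construct.Interior.Symmetric as SymInterior using (_,_)
open import Relation.Binary.Lattice.Definitions using (Supremum; Infimum)
open import Relation.Binary.Lattice.Structures using (IsDistributiveLattice)
open import Relation.Binary.PropositionalEquality using (cong)
import Relation.Binary.Reasoning.Preorder as PreorderReasoning
import Relation.Binary.Reasoning.Setoid as SetoidReasoning

-- The join of f and g is their coproduct, the meet is the infimum of ι₁ ∘ f ∘ π₁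
-- and ι₂ ∘ g ∘ π₂.  If K and K′ reduce h to f and to g, then ⟨ K , K′ ⟩ queries
-- the meet, but on its first component it is only K restricted to dom K′.
-- Axiom (4) on domains shows that h already lies below the restricted reduction:
-- h is below a morphism with domain inside dom K′.  Distributivity is the
-- distributivity of ⊗ over coproducts, together with totality of the injections,
-- which are split monomorphisms because the category is totally connected.

-- Pairing and domains in a p-category.

module PCategoryProperties {o ℓ e} (𝒞 : PCategory o ℓ e) where
  open PCategory 𝒞

  hom-setoid : Obj → Obj → Setoid ℓ e
  hom-setoid A B = record { isEquivalence = equiv {A} {B} }

  module ≈-Reasoning {A B : Obj} = SetoidReasoning (hom-setoid A B)
  module ≈ {A B : Obj} = Setoid (hom-setoid A B)
  open ≈-Reasoning

  private
    variable
      A B C D X Y Z : Obj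
      f g h k : A ⇒ B

  ∘-resp-≈ˡ : f ≈ g → f ∘ h ≈ g ∘ h
  ∘-resp-≈ˡ p = ∘-resp-≈ p ≈.refl

  ∘-resp-≈ʳ : f ≈ g → h ∘ f ≈ h ∘ g
  ∘-resp-≈ʳ p = ∘-resp-≈ ≈.refl p

  pullˡ : f ∘ g ≈ h → f ∘ g ∘ k ≈ h ∘ k
  pullˡ p = ≈.trans (≈.sym assoc) (∘-resp-≈ˡ p)

  pullʳ : f ∘ g ≈ h → (k ∘ f) ∘ g ≈ k ∘ h
  pullʳ p = ≈.trans assoc (∘-resp-≈ʳ p)

  ⊗-split : f ⊗₁ g ≈ (f ⊗₁ id) ∘ (id ⊗₁ g)
  ⊗-split = ≈.trans (⊗-resp-≈ (≈.sym identityʳ) (≈.sym identityˡ)) ⊗-∘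

  -- Not a categorical pairing: morphisms may be partial, and projecting to one component restricts
  -- it to the domain of the other.
  ⟨_,_⟩ : X ⇒ A → X ⇒ B → X ⇒ A ⊗₀ B
  ⟨ f , g ⟩ = (f ⊗₁ g) ∘ Δ

  ⟨⟩-resp-≈ : f ≈ g → h ≈ k → ⟨ f , h ⟩ ≈ ⟨ g , k ⟩
  ⟨⟩-resp-≈ p q = ∘-resp-≈ˡ (⊗-resp-≈ p q)

  ⊗-⟨⟩ : (f ⊗₁ g) ∘ ⟨ h , k ⟩ ≈ ⟨ f ∘ h , g ∘ k ⟩
  ⊗-⟨⟩ = pullˡ (≈.sym ⊗-∘)

  ⟨⟩-∘ : ⟨ f , g ⟩ ∘ h ≈ ⟨ f ∘ h , g ∘ h ⟩
  ⟨⟩-∘ {f = f} {g = g} {h = h} = begin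
    ((f ⊗₁ g) ∘ Δ) ∘ h         ≈⟨ pullʳ (Δ-natural h) ⟩
    (f ⊗₁ g) ∘ (h ⊗₁ h) ∘ Δ    ≈⟨ ⊗-⟨⟩ ⟩
    ⟨ f ∘ h , g ∘ h ⟩          ∎

  swap-⟨⟩ : swap ∘ ⟨ f , g ⟩ ≈ ⟨ g , f ⟩
  swap-⟨⟩ {f = f} {g = g} = begin
    swap ∘ (f ⊗₁ g) ∘ Δ    ≈⟨ pullˡ (swap-natural f g) ⟩
    ((g ⊗₁ f) ∘ swap) ∘ Δ  ≈⟨ pullʳ swap-Δ ⟩
    ⟨ g , f ⟩              ∎

  assoc-⟨⟩ : α⇒ ∘ ⟨ f , ⟨ g , h ⟩ ⟩ ≈ ⟨ ⟨ f , g ⟩ , h ⟩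
  assoc-⟨⟩ {f = f} {g = g} {h = h} = begin
    α⇒ ∘ ⟨ f , ⟨ g , h ⟩ ⟩                      ≈⟨ ∘-resp-≈ʳ (⟨⟩-resp-≈ (≈.sym identityʳ) ≈.refl) ⟩
    α⇒ ∘ ⟨ f ∘ id , (g ⊗₁ h) ∘ Δ ⟩              ≈⟨ ∘-resp-≈ʳ (≈.sym ⊗-⟨⟩) ⟩
    α⇒ ∘ (f ⊗₁ (g ⊗₁ h)) ∘ (id ⊗₁ Δ) ∘ Δ        ≈⟨ pullˡ (α⇒-natural f g h) ⟩
    (((f ⊗₁ g) ⊗₁ h) ∘ α⇒) ∘ (id ⊗₁ Δ) ∘ Δ      ≈⟨ pullʳ α⇒-Δ ⟩
    ((f ⊗₁ g) ⊗₁ h) ∘ (Δ ⊗₁ id) ∘ Δ             ≈⟨ ⊗-⟨⟩ ⟩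
    ⟨ (f ⊗₁ g) ∘ Δ , h ∘ id ⟩                   ≈⟨ ⟨⟩-resp-≈ ≈.refl identityʳ ⟩
    ⟨ ⟨ f , g ⟩ , h ⟩                           ∎

  -- `π₁` is natural in its first argument only, so `f` moves past it while `g` stays behind as a
  -- domain.
  π₁-⟨⟩ : π₁ ∘ ⟨ f , g ⟩ ≈ f ∘ dom g
  π₁-⟨⟩ {f = f} {g = g} = begin
    π₁ ∘ (f ⊗₁ g) ∘ Δ                ≈⟨ ∘-resp-≈ʳ (≈.trans (∘-resp-≈ˡ ⊗-split) assoc) ⟩
    π₁ ∘ (f ⊗₁ id) ∘ (id ⊗₁ g) ∘ Δ   ≈⟨ pullˡ (π₁-natural f) ⟩
    (f ∘ π₁) ∘ (id ⊗₁ g) ∘ Δ         ≈⟨ assoc ⟩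
    f ∘ dom g                        ∎

  π₂-⟨⟩ : π₂ ∘ ⟨ f , g ⟩ ≈ g ∘ dom f
  π₂-⟨⟩ {f = f} {g = g} = begin
    π₂ ∘ ⟨ f , g ⟩         ≈⟨ ∘-resp-≈ˡ π₁-swap ⟨
    (π₁ ∘ swap) ∘ ⟨ f , g ⟩ ≈⟨ pullʳ swap-⟨⟩ ⟩
    π₁ ∘ ⟨ g , f ⟩         ≈⟨ π₁-⟨⟩ ⟩
    g ∘ dom f              ∎

  -- The calculus of domains.

  dom-resp-≈ : f ≈ g → dom f ≈ dom g
  dom-resp-≈ p = ∘-resp-≈ʳ (⟨⟩-resp-≈ ≈.refl p)

  dom-id : dom (id {A}) ≈ id
  dom-id = ≈.trans (∘-resp-≈ʳ (≈.trans (∘-resp-≈ˡ ⊗-id) identityˡ)) π₁-Δ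

  π₂-⟨id,⟩ : π₂ ∘ ⟨ id , f ⟩ ≈ f
  π₂-⟨id,⟩ = ≈.trans π₂-⟨⟩ (≈.trans (∘-resp-≈ʳ dom-id) identityʳ)

  -- Naturality of `Δ` turns the pair of `f` with itself into `Δ ∘ f`, which `π₁` sends back to `f`.
  dom-idʳ : f ∘ dom f ≈ f
  dom-idʳ {f = f} = begin
    f ∘ dom f           ≈⟨ π₁-⟨⟩ ⟨
    π₁ ∘ (f ⊗₁ f) ∘ Δ   ≈⟨ ∘-resp-≈ʳ (Δ-natural f) ⟨
    π₁ ∘ Δ ∘ f          ≈⟨ pullˡ π₁-Δ ⟩
    id ∘ f              ≈⟨ identityˡ ⟩
    f                   ∎

  -- The projections of `⟨ id , f ⟩` are `dom f` and `f`, and `π₁⊗π₂-Δ` rebuilds a pair from its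
  -- projections.
  ⟨dom,⟩ : ⟨ dom f , f ⟩ ≈ ⟨ id , f ⟩
  ⟨dom,⟩ {f = f} = begin
    ⟨ dom f , f ⟩                             ≈⟨ ⟨⟩-resp-≈ ≈.refl π₂-⟨id,⟩ ⟨
    ⟨ π₁ ∘ ⟨ id , f ⟩ , π₂ ∘ ⟨ id , f ⟩ ⟩     ≈⟨ ⟨⟩-∘ ⟨
    ⟨ π₁ , π₂ ⟩ ∘ ⟨ id , f ⟩                  ≈⟨ ∘-resp-≈ˡ π₁⊗π₂-Δ ⟩
    id ∘ ⟨ id , f ⟩                           ≈⟨ identityˡ ⟩
    ⟨ id , f ⟩                                ∎

  -- An intersection of domains is again a domain, hence axiom (4) can be applied to it.
  -- Reassociating the triple of `id`, `f` and `g` gives the equation.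
  dom-∘-dom : dom f ∘ dom g ≈ dom ⟨ f , g ⟩
  dom-∘-dom {f = f} {g = g} = begin
    dom f ∘ dom g                                    ≈⟨ π₁-⟨⟩ ⟨
    π₁ ∘ ⟨ π₁ ∘ ⟨ id , f ⟩ , g ⟩                     ≈⟨ ∘-resp-≈ʳ (⟨⟩-resp-≈ ≈.refl identityˡ) ⟨
    π₁ ∘ ⟨ π₁ ∘ ⟨ id , f ⟩ , id ∘ g ⟩                ≈⟨ ∘-resp-≈ʳ ⊗-⟨⟩ ⟨
    π₁ ∘ (π₁ ⊗₁ id) ∘ ⟨ ⟨ id , f ⟩ , g ⟩             ≈⟨ pullˡ (π₁-natural π₁) ⟩
    (π₁ ∘ π₁) ∘ ⟨ ⟨ id , f ⟩ , g ⟩                   ≈⟨ ∘-resp-≈ʳ assoc-⟨⟩ ⟨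
    (π₁ ∘ π₁) ∘ α⇒ ∘ ⟨ id , ⟨ f , g ⟩ ⟩              ≈⟨ pullˡ (≈.trans (pullʳ π₁-α⇒) π₁-id⊗π₁) ⟩
    dom ⟨ f , g ⟩                                    ∎

  -- Together with `dom-∘-dom` this makes domains commute. The outer `π₁` absorbs either projection
  -- of the second factor, so it cannot see the swap.
  dom-swap : dom ⟨ f , g ⟩ ≈ dom ⟨ g , f ⟩
  dom-swap {f = f} {g = g} = begin
    π₁ ∘ ⟨ id , ⟨ f , g ⟩ ⟩                  ≈⟨ ∘-resp-≈ʳ (⟨⟩-resp-≈ identityˡ swap-⟨⟩) ⟨
    π₁ ∘ ⟨ id ∘ id , swap ∘ ⟨ g , f ⟩ ⟩      ≈⟨ ∘-resp-≈ʳ ⊗-⟨⟩ ⟨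
    π₁ ∘ (id ⊗₁ swap) ∘ ⟨ id , ⟨ g , f ⟩ ⟩   ≈⟨ pullˡ π₁-id⊗swap ⟩
    π₁ ∘ ⟨ id , ⟨ g , f ⟩ ⟩                  ∎
    where
    π₁-id⊗swap : π₁ ∘ (id {X} ⊗₁ swap {Y} {Z}) ≈ π₁
    π₁-id⊗swap = begin
      π₁ ∘ (id ⊗₁ swap)                  ≈⟨ ∘-resp-≈ˡ π₁-id⊗π₁ ⟨
      (π₁ ∘ (id ⊗₁ π₁)) ∘ (id ⊗₁ swap)   ≈⟨ pullʳ (≈.sym ⊗-∘) ⟩
      π₁ ∘ ((id ∘ id) ⊗₁ (π₁ ∘ swap))    ≈⟨ ∘-resp-≈ʳ (⊗-resp-≈ identityˡ π₁-swap) ⟩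
      π₁ ∘ (id ⊗₁ π₂)                    ≈⟨ π₁-id⊗π₂ ⟩
      π₁                                 ∎

  dom-∘dom : dom (f ∘ dom g) ≈ dom f ∘ dom g
  dom-∘dom {f = f} {g = g} = begin
    π₁ ∘ ⟨ id , f ∘ dom g ⟩                 ≈⟨ ∘-resp-≈ʳ (⟨⟩-resp-≈ identityˡ π₁-⟨⟩) ⟨
    π₁ ∘ ⟨ id ∘ id , π₁ ∘ ⟨ f , g ⟩ ⟩       ≈⟨ ∘-resp-≈ʳ ⊗-⟨⟩ ⟨
    π₁ ∘ (id ⊗₁ π₁) ∘ ⟨ id , ⟨ f , g ⟩ ⟩    ≈⟨ pullˡ π₁-id⊗π₁ ⟩
    dom ⟨ f , g ⟩                           ≈⟨ dom-∘-dom ⟨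
    dom f ∘ dom g                           ∎

  dom-idem : dom f ∘ dom f ≈ dom f
  dom-idem = ≈.trans (≈.sym dom-∘dom) (dom-resp-≈ dom-idʳ)

  dom-⟨⟩-⊆ : dom ⟨ f , g ⟩ ⊆ dom f
  dom-⟨⟩-⊆ {f = f} {g = g} = begin
    dom ⟨ f , g ⟩ ∘ dom f     ≈⟨ ∘-resp-≈ˡ (≈.trans dom-swap (≈.sym dom-∘-dom)) ⟩
    (dom g ∘ dom f) ∘ dom f   ≈⟨ pullʳ dom-idem ⟩
    dom g ∘ dom f             ≈⟨ dom-∘-dom ⟩
    dom ⟨ g , f ⟩             ≈⟨ dom-swap ⟩
    dom ⟨ f , g ⟩             ∎

  dom-∘-⊆ : dom (g ∘ f) ⊆ dom f
  dom-∘-⊆ = ≈.trans (≈.sym dom-∘dom) (dom-resp-≈ (pullʳ dom-idʳ))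

  -- `dom (g ∘ f)` is contained in `dom f`, so a total composite forces its first factor to be
  -- total.
  dom-total : dom (g ∘ f) ≈ id → dom f ≈ id
  dom-total {g = g} {f = f} p = begin
    dom f                 ≈⟨ identityˡ ⟨
    id ∘ dom f            ≈⟨ ∘-resp-≈ˡ p ⟨
    dom (g ∘ f) ∘ dom f   ≈⟨ dom-∘-⊆ ⟩
    dom (g ∘ f)           ≈⟨ p ⟩
    id                    ∎

  dom-π₂ : dom (π₂ {X} {Y}) ≈ id
  dom-π₂ = ≈.trans (pullˡ π₁-id⊗π₂) π₁-Δ

  -- Naturality of `π₁` in its second argument fails for partial morphisms; a section is total,
  -- because composing it with its retraction gives a total morphism.
  π₁-id⊗section : g ∘ f ≈ id → π₁ ∘ (id {X} ⊗₁ f) ≈ π₁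
  π₁-id⊗section {g = g} {f = f} g∘f≈id = begin
    π₁ ∘ (id ⊗₁ f)                  ≈⟨ ∘-resp-≈ʳ identityʳ ⟨
    π₁ ∘ (id ⊗₁ f) ∘ id             ≈⟨ ∘-resp-≈ʳ (∘-resp-≈ʳ π₁⊗π₂-Δ) ⟨
    π₁ ∘ (id ⊗₁ f) ∘ ⟨ π₁ , π₂ ⟩    ≈⟨ ∘-resp-≈ʳ ⊗-⟨⟩ ⟩
    π₁ ∘ ⟨ id ∘ π₁ , f ∘ π₂ ⟩       ≈⟨ π₁-⟨⟩ ⟩
    (id ∘ π₁) ∘ dom (f ∘ π₂)        ≈⟨ ∘-resp-≈ identityˡ (dom-total dom-g∘f∘π₂) ⟩
    π₁ ∘ id                         ≈⟨ identityʳ ⟩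
    π₁                              ∎
    where
    dom-g∘f∘π₂ : dom (g ∘ f ∘ π₂) ≈ id
    dom-g∘f∘π₂ = ≈.trans (dom-resp-≈ (≈.trans (pullˡ g∘f≈id) identityˡ)) dom-π₂

  -- By `⟨dom,⟩` the first component may be taken to be the domain of the second, so it records the
  -- restriction automatically.
  ⟨id,⟩-∘dom : ⟨ id , f ⟩ ∘ dom g ≈ ⟨ id , f ∘ dom g ⟩
  ⟨id,⟩-∘dom {f = f} {g = g} = begin
    ⟨ id , f ⟩ ∘ dom g                    ≈⟨ ∘-resp-≈ˡ ⟨dom,⟩ ⟨
    ⟨ dom f , f ⟩ ∘ dom g                 ≈⟨ ⟨⟩-∘ ⟩
    ⟨ dom f ∘ dom g , f ∘ dom g ⟩         ≈⟨ ⟨⟩-resp-≈ dom-∘dom ≈.refl ⟨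
    ⟨ dom (f ∘ dom g) , f ∘ dom g ⟩       ≈⟨ ⟨dom,⟩ ⟩
    ⟨ id , f ∘ dom g ⟩                    ∎

  ⟨id,∘⟩-dom : ⟨ id , g ∘ f ⟩ ∘ dom f ≈ ⟨ id , g ∘ f ⟩
  ⟨id,∘⟩-dom = ≈.trans ⟨id,⟩-∘dom (⟨⟩-resp-≈ ≈.refl (pullʳ dom-idʳ))

  -- (id ⊗₁ Δ) ∘ Δ = α⇐ ∘ (Δ ⊗₁ id) ∘ Δ lets the inner reduction reuse the input
  -- of the outer one.
  nested-reduction : ∀ {E F} {H : A ⊗₀ D ⇒ B} {K : A ⇒ C} {H′ : C ⊗₀ F ⇒ D} {K′ : C ⇒ E}
    {h : E ⇒ F} →
    H ∘ ⟨ id , (H′ ∘ ⟨ id , h ∘ K′ ⟩) ∘ K ⟩ ≈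
    (H ∘ (id ⊗₁ (H′ ∘ (K ⊗₁ id))) ∘ α⇐ ∘ (Δ ⊗₁ id)) ∘ ⟨ id , h ∘ K′ ∘ K ⟩
  nested-reduction {A = A} {F = F} {H = H} {K} {H′} {K′} {h} = begin
    H ∘ ⟨ id , (H′ ∘ ⟨ id , h ∘ K′ ⟩) ∘ K ⟩
      ≈⟨ ∘-resp-≈ʳ (⟨⟩-resp-≈ (≈.sym identityˡ) query) ⟩
    H ∘ ⟨ id ∘ id , (H′ ∘ (K ⊗₁ id)) ∘ ⟨ id , q ⟩ ⟩
      ≈⟨ ∘-resp-≈ʳ ⊗-⟨⟩ ⟨
    H ∘ (id ⊗₁ (H′ ∘ (K ⊗₁ id))) ∘ ⟨ id , ⟨ id , q ⟩ ⟩
      ≈⟨ ∘-resp-≈ʳ (∘-resp-≈ʳ duplicate) ⟨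
    H ∘ (id ⊗₁ (H′ ∘ (K ⊗₁ id))) ∘ (α⇐ ∘ (Δ ⊗₁ id)) ∘ ⟨ id , q ⟩
      ≈⟨ ≈.trans assoc (∘-resp-≈ʳ assoc) ⟨
    (H ∘ (id ⊗₁ (H′ ∘ (K ⊗₁ id))) ∘ α⇐ ∘ (Δ ⊗₁ id)) ∘ ⟨ id , q ⟩
      ∎
    where
    q : A ⇒ F
    q = h ∘ K′ ∘ K

    query : (H′ ∘ ⟨ id , h ∘ K′ ⟩) ∘ K ≈ (H′ ∘ (K ⊗₁ id)) ∘ ⟨ id , q ⟩
    query = begin
      (H′ ∘ ⟨ id , h ∘ K′ ⟩) ∘ K        ≈⟨ pullʳ ⟨⟩-∘ ⟩
      H′ ∘ ⟨ id ∘ K , (h ∘ K′) ∘ K ⟩    ≈⟨ ∘-resp-≈ʳ (⟨⟩-resp-≈ (≈.trans identityˡ (≈.sym identityʳ))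
                                                                (≈.trans assoc (≈.sym identityˡ))) ⟩
      H′ ∘ ⟨ K ∘ id , id ∘ q ⟩          ≈⟨ pullʳ ⊗-⟨⟩ ⟨
      (H′ ∘ (K ⊗₁ id)) ∘ ⟨ id , q ⟩     ∎

    duplicate : (α⇐ ∘ (Δ ⊗₁ id)) ∘ ⟨ id , q ⟩ ≈ ⟨ id , ⟨ id , q ⟩ ⟩
    duplicate = begin
      (α⇐ ∘ (Δ ⊗₁ id)) ∘ ⟨ id , q ⟩      ≈⟨ pullʳ ⊗-⟨⟩ ⟩
      α⇐ ∘ ⟨ Δ ∘ id , id ∘ q ⟩           ≈⟨ ∘-resp-≈ʳ (⟨⟩-resp-≈ (≈.trans identityʳ
                                              (≈.sym (≈.trans (∘-resp-≈ˡ ⊗-id) identityˡ))) identityˡ) ⟩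
      α⇐ ∘ ⟨ ⟨ id , id ⟩ , q ⟩           ≈⟨ ∘-resp-≈ʳ assoc-⟨⟩ ⟨
      α⇐ ∘ α⇒ ∘ ⟨ id , ⟨ id , q ⟩ ⟩      ≈⟨ pullˡ α⇐-α⇒ ⟩
      id ∘ ⟨ id , ⟨ id , q ⟩ ⟩           ≈⟨ identityˡ ⟩
      ⟨ id , ⟨ id , q ⟩ ⟩                ∎

-- Monotonicity and restriction to a domain.

module PosetEnrichedProperties {o ℓ e p c} (𝒞 : PosetEnrichedPCategory o ℓ e p c) where
  open PosetEnrichedPCategory 𝒞
  open PCategoryProperties pCategory public

  hom-preorder : Obj → Obj → Preorder ℓ e p
  hom-preorder A B = record { isPreorder = isPreorder {A} {B} }

  module ⪯-Reasoning {A B : Obj} = PreorderReasoning (hom-preorder A B)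
  module ⪯ {A B : Obj} = Preorder (hom-preorder A B)
  open ⪯-Reasoning

  private
    variable
      A B C D : Obj
      f g h u v : A ⇒ B

  ∘-monoˡ : f ⪯ g → f ∘ h ⪯ g ∘ h
  ∘-monoˡ {f = f} {g = g} {h = h} f⪯g = begin
    f ∘ h        ≈⟨ identityˡ ⟨
    id ∘ f ∘ h   ≲⟨ ∘-mono id h f⪯g ⟩
    id ∘ g ∘ h   ≈⟨ identityˡ ⟩
    g ∘ h        ∎

  ∘-monoʳ : f ⪯ g → h ∘ f ⪯ h ∘ g
  ∘-monoʳ {f = f} {g = g} {h = h} f⪯g = begin
    h ∘ f        ≈⟨ ∘-resp-≈ʳ identityʳ ⟨
    h ∘ f ∘ id   ≲⟨ ∘-mono h id f⪯g ⟩
    h ∘ g ∘ id   ≈⟨ ∘-resp-≈ʳ identityʳ ⟩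
    h ∘ g        ∎

  ⟨⟩-monoʳ : f ⪯ g → ⟨ h , f ⟩ ⪯ ⟨ h , g ⟩
  ⟨⟩-monoʳ {f = f} {g = g} {h = h} f⪯g = begin
    ⟨ h , f ⟩         ≈⟨ swap-⟨⟩ ⟨
    swap ∘ ⟨ f , h ⟩  ≲⟨ ∘-mono swap Δ (⊗-mono h f⪯g) ⟩
    swap ∘ ⟨ g , h ⟩  ≈⟨ swap-⟨⟩ ⟩
    ⟨ h , g ⟩         ∎

  dom-mono : f ⪯ g → dom f ⪯ dom g
  dom-mono f⪯g = ∘-monoʳ (⟨⟩-monoʳ f⪯g)

  -- Inclusion of domains does not imply ⪯, so dom v cannot simply be enlarged to
  -- dom g.  Axiom (4) applies to dom h ∘ dom v ⊆ dom h ∘ dom g ⊆ dom h.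
  ⪯-restrict : h ⪯ u → h ⪯ v → v ∘ dom g ≈ v → h ⪯ u ∘ dom g
  ⪯-restrict {h = h} {u = u} {v = v} {g = g} h⪯u h⪯v v∘dg≈v = begin
    h                      ≈⟨ dom-idʳ ⟨
    h ∘ dom h              ≲⟨ ∘-monoʳ (dom-⪯ ⟨ h , v ⟩ ⟨ h , g ⟩ h hv⊆hg dom-⟨⟩-⊆ h⪯hv) ⟩
    h ∘ dom ⟨ h , g ⟩      ≈⟨ ∘-resp-≈ʳ dom-∘-dom ⟨
    h ∘ dom h ∘ dom g      ≈⟨ pullˡ dom-idʳ ⟩
    h ∘ dom g              ≲⟨ ∘-monoˡ h⪯u ⟩
    u ∘ dom g              ∎
    where
    h⪯hv : dom h ⪯ dom ⟨ h , v ⟩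
    h⪯hv = begin
      dom h            ≈⟨ dom-idem ⟨
      dom h ∘ dom h    ≲⟨ ∘-monoʳ (dom-mono h⪯v) ⟩
      dom h ∘ dom v    ≈⟨ dom-∘-dom ⟩
      dom ⟨ h , v ⟩    ∎

    hv⊆g : dom ⟨ h , v ⟩ ∘ dom g ≈ dom ⟨ h , v ⟩
    hv⊆g = ≈.trans (∘-resp-≈ˡ (≈.sym dom-∘-dom))
          (≈.trans (pullʳ (≈.trans (≈.sym dom-∘dom) (dom-resp-≈ v∘dg≈v))) dom-∘-dom)

    hv⊆hg : dom ⟨ h , v ⟩ ⊆ dom ⟨ h , g ⟩
    hv⊆hg = ≈.trans (∘-resp-≈ʳ (≈.sym dom-∘-dom)) (≈.trans (pullˡ dom-⟨⟩-⊆) hv⊆g)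

-- Infima of morphisms.

module MeetSemilatticeEnrichedProperties {o ℓ e p c}
       (𝒞 : MeetSemilatticeEnrichedPCategory o ℓ e p c) where
  open MeetSemilatticeEnrichedPCategory 𝒞
  open PosetEnrichedProperties posetEnriched public
  open ⪯-Reasoning

  private
    variable
      A B C D : Obj
      f g h k : A ⇒ B

  inf-lowerˡ : inf f g ⪯ f
  inf-lowerˡ {f = f} {g = g} = proj₁ (inf-infimum f g)

  inf-lowerʳ : inf f g ⪯ g
  inf-lowerʳ {f = f} {g = g} = proj₁ (proj₂ (inf-infimum f g))

  inf-greatest : h ⪯ f → h ⪯ g → h ⪯ inf f g
  inf-greatest {h = h} {f = f} {g = g} = proj₂ (proj₂ (inf-infimum f g)) h

  inf-mono : f ⪯ g → h ⪯ k → inf f h ⪯ inf g k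
  inf-mono f⪯g h⪯k =
    inf-greatest (⪯.trans inf-lowerˡ f⪯g) (⪯.trans inf-lowerʳ h⪯k)

  inf-∘-⪯ : inf (f ∘ h) (g ∘ h) ⪯ inf f g ∘ h
  inf-∘-⪯ {f = f} {h = h} {g = g} = begin
    inf (f ∘ h) (g ∘ h)             ≲⟨ inf-mono (⪯.reflexive (≈.sym identityˡ)) (⪯.reflexive (≈.sym identityˡ)) ⟩
    inf (id ∘ f ∘ h) (id ∘ g ∘ h)   ≲⟨ SymInterior.rhs≤lhs (∘-inf id f g h) ⟩
    id ∘ inf f g ∘ h                ≈⟨ identityˡ ⟩
    inf f g ∘ h                     ∎

  -- Both bounds share `H` and `K`, so the infimum can be carried inward through each operation that
  -- builds the reduction.
  ⪯-inf-reduction : ∀ {H : A ⊗₀ D ⇒ B} {K : A ⇒ C} →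
    f ⪯ H ∘ ⟨ id , g ∘ K ⟩ → f ⪯ H ∘ ⟨ id , h ∘ K ⟩ → f ⪯ H ∘ ⟨ id , inf g h ∘ K ⟩
  ⪯-inf-reduction {f = f} {g = g} {h = h} {H = H} {K = K} f⪯g f⪯h = begin
    f                                                ≲⟨ inf-greatest f⪯g f⪯h ⟩
    inf (H ∘ ⟨ id , g ∘ K ⟩) (H ∘ ⟨ id , h ∘ K ⟩)    ≲⟨ SymInterior.rhs≤lhs (∘-inf H _ _ Δ) ⟩
    H ∘ inf (id ⊗₁ (g ∘ K)) (id ⊗₁ (h ∘ K)) ∘ Δ      ≲⟨ ∘-mono H Δ (SymInterior.rhs≤lhs (⊗-inf id _ _)) ⟩
    H ∘ ⟨ id , inf (g ∘ K) (h ∘ K) ⟩                 ≲⟨ ∘-monoʳ (⟨⟩-monoʳ inf-∘-⪯) ⟩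
    H ∘ ⟨ id , inf g h ∘ K ⟩                         ∎

-- Binary coproducts in a many-one category extension.

module ManyOneProperties {o ℓ e p s c} {α : Set c}
       (M : ManyOneCategoryExtension o ℓ e p s α) (2≤α : Fin 2 ↣ α) where
  open ManyOneCategoryExtension M
  open MeetSemilatticeEnrichedProperties 𝒫

  private
    variable
      A B C D X Y : Obj
      f g h k : A ⇒ B

  -- Lifted because index types must live in the universe of `α`.
  Two : Set c
  Two = Lift c (Fin 2)

  pattern left  = lift zero
  pattern right = lift (suc zero)

  two : NonzeroSizeUpTo α
  two = record
    { Index   = Two
    ; element = left
    ; inject  = 2≤α ↣-∘ mk↣ {to = lower} (cong lift)
    }

  both : ∀ {a} {P : Two → Set a} → P left → P right → ∀ j → P j
  both x y left  = x
  both x y right = y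

  open ∐[_] two

  infixr 9 _⊕₀_ _⊕₁_
  _⊕₀_ : Obj → Obj → Obj
  A ⊕₀ B = ∐ (both A B)

  ι₁ : A ⇒ A ⊕₀ B
  ι₁ {A} {B} = ι {both A B} left

  ι₂ : B ⇒ A ⊕₀ B
  ι₂ {B} {A} = ι {both A B} right

  [_,_] : A ⇒ X → B ⇒ X → A ⊕₀ B ⇒ X
  [_,_] {A} {X} {B} f g = copair {both A B} (both f g)

  []-ι₁ : [ f , g ] ∘ ι₁ ≈ f
  []-ι₁ = Coproduct.copair-ι (coproduct _) _ left

  []-ι₂ : [ f , g ] ∘ ι₂ ≈ g
  []-ι₂ = Coproduct.copair-ι (coproduct _) _ right

  ι-jointly-epi : ∀ {B : Two → Obj} {f g : ∐ B ⇒ X} →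
    (∀ j → f ∘ ι j ≈ g ∘ ι j) → f ≈ g
  ι-jointly-epi {B = B} {f} {g} p =
    ≈.trans (Coproduct.unique (coproduct B) _ f p)
            (≈.sym (Coproduct.unique (coproduct B) _ g (λ _ → ≈.refl)))

  ⊕-ext : {f g : A ⊕₀ B ⇒ X} → f ∘ ι₁ ≈ g ∘ ι₁ → f ∘ ι₂ ≈ g ∘ ι₂ → f ≈ g
  ⊕-ext p q = ι-jointly-epi (both p q)

  _⊕₁_ : A ⇒ C → B ⇒ D → A ⊕₀ B ⇒ C ⊕₀ D
  _⊕₁_ {A} {C} {B} {D} f g = ∐₁ {both A B} {both C D} (both f g)

  ⊕-ι₁ : (f ⊕₁ g) ∘ ι₁ ≈ ι₁ ∘ f
  ⊕-ι₁ = Coproduct.copair-ι (coproduct _) _ left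

  ⊕-ι₂ : (f ⊕₁ g) ∘ ι₂ ≈ ι₂ ∘ g
  ⊕-ι₂ = Coproduct.copair-ι (coproduct _) _ right

  ⊕-mono : f ⪯ g → h ⪯ k → f ⊕₁ h ⪯ g ⊕₁ k
  ⊕-mono f⪯g h⪯k = ∐-mono (coproduct _) (coproduct _) (both f⪯g h⪯k)

  ⊕-inf-⪯ : {f g : A ⇒ C} {h k : B ⇒ D} → inf (f ⊕₁ h) (g ⊕₁ k) ⪯ inf f g ⊕₁ inf h k
  ⊕-inf-⪯ {f = f} {g} {h} {k} = ⪯.trans
    (SymInterior.lhs≤rhs (∐-inf (coproduct _) (coproduct _) (both f h) (both g k)))
    -- The family given by `∐-inf` agrees with `both (inf f g) (inf h k)` only index by index, and
    -- monotonicity needs no more than that.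
    (∐-mono (coproduct _) (coproduct _) (both ⪯.refl ⪯.refl))

  -- The universal property of id ⊗₁ ι₁ and id ⊗₁ ι₂ as coproduct injections.
  ⊗[_,_] : A ⊗₀ B ⇒ X → A ⊗₀ C ⇒ X → A ⊗₀ (B ⊕₀ C) ⇒ X
  ⊗[_,_] {A} {B} {X} {C} f g = copair {λ j → A ⊗₀ both B C j} (both f g) ∘ distrib

  ⊗[]-ι₁ : ⊗[ f , g ] ∘ (id ⊗₁ ι₁) ≈ f
  ⊗[]-ι₁ = ≈.trans (pullʳ (distrib-ι left)) (Coproduct.copair-ι (coproduct _) _ left)

  ⊗[]-ι₂ : ⊗[ f , g ] ∘ (id ⊗₁ ι₂) ≈ g
  ⊗[]-ι₂ = ≈.trans (pullʳ (distrib-ι right)) (Coproduct.copair-ι (coproduct _) _ right)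

  -- Precomposing with the inverse of `distrib` reduces the claim to joint epimorphy of coproduct
  -- injections.
  ⊗⊕-ext : {f g : A ⊗₀ (B ⊕₀ C) ⇒ X} →
    f ∘ (id ⊗₁ ι₁) ≈ g ∘ (id ⊗₁ ι₁) → f ∘ (id ⊗₁ ι₂) ≈ g ∘ (id ⊗₁ ι₂) → f ≈ g
  ⊗⊕-ext {A} {B} {C} {f = f} {g = g} p q = begin
    f                          ≈⟨ identityʳ ⟨
    f ∘ id                     ≈⟨ ∘-resp-≈ʳ distrib-invˡ ⟨
    f ∘ distrib⁻¹ ∘ distrib    ≈⟨ pullˡ (ι-jointly-epi λ j → ≈.trans (pullʳ (distrib⁻¹-ι j))
                                   (≈.trans (agree j) (≈.sym (pullʳ (distrib⁻¹-ι j))))) ⟩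
    (g ∘ distrib⁻¹) ∘ distrib  ≈⟨ pullʳ distrib-invˡ ⟩
    g ∘ id                     ≈⟨ identityʳ ⟩
    g                          ∎
    where
    open ≈-Reasoning

    distrib⁻¹-ι : ∀ j → distrib⁻¹ {A} {both B C} ∘ ι j ≈ id ⊗₁ ι j
    distrib⁻¹-ι j = begin
      distrib⁻¹ ∘ ι j                      ≈⟨ ∘-resp-≈ʳ (distrib-ι j) ⟨
      distrib⁻¹ ∘ distrib ∘ (id ⊗₁ ι j)    ≈⟨ pullˡ distrib-invˡ ⟩
      id ∘ (id ⊗₁ ι j)                     ≈⟨ identityˡ ⟩
      id ⊗₁ ι j                            ∎

    agree : ∀ j → f ∘ (id ⊗₁ ι {both B C} j) ≈ g ∘ (id ⊗₁ ι j)
    agree = both p q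

  -- Total connectedness supplies the retraction: `connect` is the default on the other summand.
  ι₁-section : [ id , connect B A ] ∘ ι₁ ≈ id
  ι₁-section = []-ι₁

  ι₂-section : [ connect A B , id ] ∘ ι₂ ≈ id
  ι₂-section = []-ι₂

  𝒮-ι₁ : 𝒮 (ι₁ {A} {B})
  𝒮-ι₁ {A} {B} = 𝒮-ι two {both A B} left

  𝒮-ι₂ : 𝒮 (ι₂ {B} {A})
  𝒮-ι₂ {B} {A} = 𝒮-ι two {both A B} right

  𝒮-[] : {f : A ⇒ X} {g : B ⇒ X} → 𝒮 f → 𝒮 g → 𝒮 [ f , g ]
  𝒮-[] {A} {B = B} p q = 𝒮-copair two {both A B} (both p q)

  𝒮-⊗[] : {f : A ⊗₀ B ⇒ X} {g : A ⊗₀ C ⇒ X} → 𝒮 f → 𝒮 g → 𝒮 ⊗[ f , g ]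
  𝒮-⊗[] {A} {B} {C = C} p q =
    𝒮-∘ (𝒮-copair two {λ j → A ⊗₀ both B C j} (both p q)) (𝒮-distrib two)

  -- The preorder of many-one reductions.

  ≤ₘ-refl : Reflexive _≤ₘ_
  ≤ₘ-refl = π₂ , id , 𝒮-π₂ , 𝒮-id ,
    ⪯.reflexive (≈.sym (≈.trans π₂-⟨id,⟩ identityʳ))

  ≤ₘ-trans : Transitive _≤ₘ_
  ≤ₘ-trans (H , K , 𝒮H , 𝒮K , f⪯) (H′ , K′ , 𝒮H′ , 𝒮K′ , g⪯) =
    H ∘ (id ⊗₁ (H′ ∘ (K ⊗₁ id))) ∘ α⇐ ∘ (Δ ⊗₁ id) , K′ ∘ K ,
    𝒮-∘ 𝒮H (𝒮-∘ (𝒮-⊗ 𝒮-id (𝒮-∘ 𝒮H′ (𝒮-⊗ 𝒮K 𝒮-id))) (𝒮-∘ 𝒮-α⇐ (𝒮-⊗ 𝒮-Δ 𝒮-id))) ,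
    𝒮-∘ 𝒮K′ 𝒮K ,
    ⪯.trans f⪯ (⪯.trans (∘-monoʳ (⟨⟩-monoʳ (∘-monoˡ g⪯))) (⪯.reflexive nested-reduction))

  -- Joins and meets.

  infixr 6 _∨_
  infixr 7 _∧_
  -- In the meet, projections and injections bring `f` and `g` into one hom-set; the injections also
  -- tag which of the two was answered.
  _∨_ _∧_ : Morphism → Morphism → Morphism
  (A , B , f) ∨ (C , D , g) = A ⊕₀ C , B ⊕₀ D , f ⊕₁ g
  (A , B , f) ∧ (C , D , g) = A ⊗₀ C , B ⊕₀ D , inf (ι₁ ∘ f ∘ π₁) (ι₂ ∘ g ∘ π₂)

  -- The reductions whose outer part forgets the input: `H ∘ π₂` returns the processed answer, since
  -- pairing with the total `id` loses nothing.
  ≤ₘ-post : ∀ {A B C D} {f : A ⇒ B} {g : C ⇒ D} {H : D ⇒ B} {K : A ⇒ C} →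
    𝒮 H → 𝒮 K → f ⪯ H ∘ g ∘ K → (A , B , f) ≤ₘ (C , D , g)
  ≤ₘ-post {H = H} {K} 𝒮H 𝒮K f⪯ =
    H ∘ π₂ , K , 𝒮-∘ 𝒮H 𝒮-π₂ , 𝒮K , ⪯.trans f⪯ (⪯.reflexive (≈.sym (pullʳ π₂-⟨id,⟩)))

  ∨-supremum : Supremum _≤ₘ_ _∨_
  ∨-supremum x@(A , B , f) y@(C , D , g) = upperˡ , upperʳ , least
    where
    upperˡ : x ≤ₘ x ∨ y
    upperˡ = ≤ₘ-post (𝒮-[] 𝒮-id (𝒮-connect D B)) 𝒮-ι₁ (begin
      f                                          ≈⟨ identityˡ ⟨
      id ∘ f                                     ≈⟨ pullˡ ι₁-section ⟨
      [ id , connect D B ] ∘ ι₁ ∘ f              ≈⟨ ∘-resp-≈ʳ ⊕-ι₁ ⟨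
      [ id , connect D B ] ∘ (f ⊕₁ g) ∘ ι₁       ∎)
      where open ⪯-Reasoning

    upperʳ : y ≤ₘ x ∨ y
    upperʳ = ≤ₘ-post (𝒮-[] (𝒮-connect B D) 𝒮-id) 𝒮-ι₂ (begin
      g                                          ≈⟨ identityˡ ⟨
      id ∘ g                                     ≈⟨ pullˡ ι₂-section ⟨
      [ connect B D , id ] ∘ ι₂ ∘ g              ≈⟨ ∘-resp-≈ʳ ⊕-ι₂ ⟨
      [ connect B D , id ] ∘ (f ⊕₁ g) ∘ ι₂       ∎)
      where open ⪯-Reasoning

    least : ∀ z → x ≤ₘ z → y ≤ₘ z → x ∨ y ≤ₘ z
    least (E , F , h) (H , K , 𝒮H , 𝒮K , f⪯) (H′ , K′ , 𝒮H′ , 𝒮K′ , g⪯) =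
      -- The summand of the input decides between `H` and `H′`. `⊗[_,_]` splits a coproduct in the
      -- second factor, while the input is the first, hence `swap`.
      W ∘ swap , [ K , K′ ] ,
      𝒮-∘ (𝒮-⊗[] (𝒮-∘ 𝒮-ι₁ (𝒮-∘ 𝒮H 𝒮-swap)) (𝒮-∘ 𝒮-ι₂ (𝒮-∘ 𝒮H′ 𝒮-swap))) 𝒮-swap ,
      𝒮-[] 𝒮K 𝒮K′ ,
      ⪯.trans (⊕-mono f⪯ g⪯) (⪯.reflexive (⊕-ext
        (≈.trans ⊕-ι₁ (≈.sym (on-injection []-ι₁ ⊗[]-ι₁)))
        (≈.trans ⊕-ι₂ (≈.sym (on-injection []-ι₂ ⊗[]-ι₂)))))
      where
      open ≈-Reasoning

      W : F ⊗₀ (A ⊕₀ C) ⇒ B ⊕₀ D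
      W = ⊗[ ι₁ ∘ H ∘ swap , ι₂ ∘ H′ ∘ swap ]

      -- One computation for both summands: `i` is the injection on inputs, `i′` the one on outputs.
      on-injection : ∀ {X Y} {i : X ⇒ A ⊕₀ C} {i′ : Y ⇒ B ⊕₀ D} {k : X ⇒ E} {w : X ⊗₀ F ⇒ Y} →
        [ K , K′ ] ∘ i ≈ k → W ∘ (id ⊗₁ i) ≈ i′ ∘ w ∘ swap →
        ((W ∘ swap) ∘ ⟨ id , h ∘ [ K , K′ ] ⟩) ∘ i ≈ i′ ∘ w ∘ ⟨ id , h ∘ k ⟩
      on-injection {i = i} {i′} {k} {w} K∘i W∘i = begin
        ((W ∘ swap) ∘ ⟨ id , h ∘ [ K , K′ ] ⟩) ∘ i     ≈⟨ ∘-resp-≈ˡ (pullʳ swap-⟨⟩) ⟩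
        (W ∘ ⟨ h ∘ [ K , K′ ] , id ⟩) ∘ i              ≈⟨ pullʳ ⟨⟩-∘ ⟩
        W ∘ ⟨ (h ∘ [ K , K′ ]) ∘ i , id ∘ i ⟩          ≈⟨ ∘-resp-≈ʳ (⟨⟩-resp-≈ (≈.trans (pullʳ K∘i) (≈.sym identityˡ))
                                                                               (≈.trans identityˡ (≈.sym identityʳ))) ⟩
        W ∘ ⟨ id ∘ h ∘ k , i ∘ id ⟩                    ≈⟨ ∘-resp-≈ʳ ⊗-⟨⟩ ⟨
        W ∘ (id ⊗₁ i) ∘ ⟨ h ∘ k , id ⟩                 ≈⟨ pullˡ W∘i ⟩
        (i′ ∘ w ∘ swap) ∘ ⟨ h ∘ k , id ⟩               ≈⟨ pullʳ (pullʳ swap-⟨⟩) ⟩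
        i′ ∘ w ∘ ⟨ id , h ∘ k ⟩                        ∎

  ∧-infimum : Infimum _≤ₘ_ _∧_
  ∧-infimum x@(A , B , f) y@(C , D , g) =
    ≤ₘ-post 𝒮-ι₁ 𝒮-π₁ inf-lowerˡ , ≤ₘ-post 𝒮-ι₂ 𝒮-π₂ inf-lowerʳ , greatest
    where
    greatest : ∀ z → z ≤ₘ x → z ≤ₘ y → z ≤ₘ x ∧ y
    greatest (E , F , h) (H , K , 𝒮H , 𝒮K , h⪯f) (H′ , K′ , 𝒮H′ , 𝒮K′ , h⪯g) =
      -- The tag on the answer decides between `H` and `H′`.
      ⊗[ H , H′ ] , ⟨ K , K′ ⟩ , 𝒮-⊗[] 𝒮H 𝒮H′ , 𝒮-∘ (𝒮-⊗ 𝒮K 𝒮K′) 𝒮-Δ ,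
      ⪯-inf-reduction
        -- The reduction to `g` queries through `K′`, so it absorbs `dom K′`; this lets the
        -- reduction to `f` be restricted to `dom K′`.
        (⪯.trans (⪯-restrict h⪯f h⪯g (pullʳ ⟨id,∘⟩-dom))
                 (⪯.reflexive (≈.sym (component ⊗[]-ι₁ π₁-⟨⟩))))
        (⪯.trans (⪯-restrict h⪯g h⪯f (pullʳ ⟨id,∘⟩-dom))
                 (⪯.reflexive (≈.sym (component ⊗[]-ι₂ π₂-⟨⟩))))
      where
      open ≈-Reasoning

      -- Serves both projections: `π` recovers `k` from the joint query only on `dom l`, and that
      -- restriction moves out of the whole reduction.
      component : ∀ {X Y Z} {i : Y ⇒ B ⊕₀ D} {w : E ⊗₀ Y ⇒ F} {π : A ⊗₀ C ⇒ X} {u : X ⇒ Y}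
        {k : E ⇒ X} {l : E ⇒ Z} →
        ⊗[ H , H′ ] ∘ (id ⊗₁ i) ≈ w → π ∘ ⟨ K , K′ ⟩ ≈ k ∘ dom l →
        ⊗[ H , H′ ] ∘ ⟨ id , (i ∘ u ∘ π) ∘ ⟨ K , K′ ⟩ ⟩ ≈ (w ∘ ⟨ id , u ∘ k ⟩) ∘ dom l
      component {i = i} {w} {π} {u} {k} {l} W∘i π∘K = begin
        ⊗[ H , H′ ] ∘ ⟨ id , (i ∘ u ∘ π) ∘ ⟨ K , K′ ⟩ ⟩        ≈⟨ ∘-resp-≈ʳ (⟨⟩-resp-≈ (≈.sym identityˡ) (pullʳ (pullʳ π∘K))) ⟩
        ⊗[ H , H′ ] ∘ ⟨ id ∘ id , i ∘ u ∘ k ∘ dom l ⟩          ≈⟨ ∘-resp-≈ʳ ⊗-⟨⟩ ⟨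
        ⊗[ H , H′ ] ∘ (id ⊗₁ i) ∘ ⟨ id , u ∘ k ∘ dom l ⟩       ≈⟨ pullˡ W∘i ⟩
        w ∘ ⟨ id , u ∘ k ∘ dom l ⟩                             ≈⟨ ∘-resp-≈ʳ (⟨⟩-resp-≈ ≈.refl assoc) ⟨
        w ∘ ⟨ id , (u ∘ k) ∘ dom l ⟩                           ≈⟨ pullʳ ⟨id,⟩-∘dom ⟨
        (w ∘ ⟨ id , u ∘ k ⟩) ∘ dom l                           ∎

  -- Distributivity of meet over join.

  ⊗⊕-factor : ∀ {A B C U V X} {f : A ⊗₀ (B ⊕₀ C) ⇒ X} {r : U ⇒ X} {r′ : V ⇒ X}
    {g : A ⊗₀ B ⇒ U} {h : A ⊗₀ C ⇒ V} →
    f ∘ (id ⊗₁ ι₁) ≈ r ∘ g → f ∘ (id ⊗₁ ι₂) ≈ r′ ∘ h →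
    f ≈ [ r , r′ ] ∘ (g ⊕₁ h) ∘ ⊗[ ι₁ , ι₂ ]
  ⊗⊕-factor f∘ι₁ f∘ι₂ = ⊗⊕-ext
    (≈.trans f∘ι₁ (≈.sym (≈.trans (pullʳ (≈.trans (pullʳ ⊗[]-ι₁) ⊕-ι₁)) (pullˡ []-ι₁))))
    (≈.trans f∘ι₂ (≈.sym (≈.trans (pullʳ (≈.trans (pullʳ ⊗[]-ι₂) ⊕-ι₂)) (pullˡ []-ι₂))))

  -- Both morphisms under the infimum factor through the same `R` and `δ`, so the infimum passes
  -- between them and then splits over the coproduct.
  ∧-distribˡ-∨-≤ₘ : ∀ x y z → x ∧ (y ∨ z) ≤ₘ (x ∧ y) ∨ (x ∧ z)
  ∧-distribˡ-∨-≤ₘ (A , B , f) (C , D , g) (E , F , h) =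
    -- `R` merges the two copies of `B` and keeps `D` and `F` apart; `δ` is the distributivity map
    -- on inputs.
    ≤ₘ-post (𝒮-[] (𝒮-[] 𝒮-ι₁ (𝒮-∘ 𝒮-ι₂ 𝒮-ι₁)) (𝒮-[] 𝒮-ι₁ (𝒮-∘ 𝒮-ι₂ 𝒮-ι₂)))
            (𝒮-⊗[] 𝒮-ι₁ 𝒮-ι₂) (begin
      inf (ι₁ ∘ f ∘ π₁) (ι₂ ∘ (g ⊕₁ h) ∘ π₂)
        ≲⟨ inf-mono
             (⪯.reflexive (⊗⊕-factor (first []-ι₁ ι₁-section) (first []-ι₁ ι₂-section)))
             (⪯.reflexive (⊗⊕-factor (second []-ι₂ ⊕-ι₁) (second []-ι₂ ⊕-ι₂))) ⟩
      inf (R ∘ ((ι₁ ∘ f ∘ π₁) ⊕₁ (ι₁ ∘ f ∘ π₁)) ∘ δ) (R ∘ ((ι₂ ∘ g ∘ π₂) ⊕₁ (ι₂ ∘ h ∘ π₂)) ∘ δ)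
        ≲⟨ SymInterior.rhs≤lhs (∘-inf R _ _ δ) ⟩
      R ∘ inf ((ι₁ ∘ f ∘ π₁) ⊕₁ (ι₁ ∘ f ∘ π₁)) ((ι₂ ∘ g ∘ π₂) ⊕₁ (ι₂ ∘ h ∘ π₂)) ∘ δ
        ≲⟨ ∘-mono R δ ⊕-inf-⪯ ⟩
      R ∘ (inf (ι₁ ∘ f ∘ π₁) (ι₂ ∘ g ∘ π₂) ⊕₁ inf (ι₁ ∘ f ∘ π₁) (ι₂ ∘ h ∘ π₂)) ∘ δ ∎)
    where
    open ⪯-Reasoning

    R : (B ⊕₀ D) ⊕₀ (B ⊕₀ F) ⇒ B ⊕₀ (D ⊕₀ F)
    R = [ [ ι₁ , ι₂ ∘ ι₁ ] , [ ι₁ , ι₂ ∘ ι₂ ] ]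

    δ : A ⊗₀ (C ⊕₀ E) ⇒ (A ⊗₀ C) ⊕₀ (A ⊗₀ E)
    δ = ⊗[ ι₁ , ι₂ ]

    -- Here `f ∘ π₁` must ignore the injection `i` in the second factor, which requires `i` to be
    -- total; the retraction `r` witnesses that.
    first : ∀ {X Y U V} {i : X ⇒ Y} {r : Y ⇒ X} {j : B ⇒ U} {w : U ⇒ V} {v : B ⇒ V} →
      w ∘ j ≈ v → r ∘ i ≈ id → (v ∘ f ∘ π₁) ∘ (id ⊗₁ i) ≈ w ∘ j ∘ f ∘ π₁
    first w∘j r∘i = ≈.trans (pullʳ (pullʳ (π₁-id⊗section r∘i))) (≈.sym (pullˡ w∘j))

    -- Naturality of `π₂` in its second argument carries `i` through to `k`.
    second : ∀ {X Y Y′ U V W} {i : X ⇒ Y} {k : Y ⇒ Y′} {u : X ⇒ U} {j : U ⇒ Y′}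
      {l : Y′ ⇒ V} {m : U ⇒ W} {w : W ⇒ V} →
      w ∘ m ≈ l ∘ j → k ∘ i ≈ j ∘ u → (l ∘ k ∘ π₂ {A}) ∘ (id ⊗₁ i) ≈ w ∘ m ∘ u ∘ π₂
    second {i = i} w∘m k∘i =
      ≈.trans (pullʳ (≈.trans (pullʳ (π₂-natural i)) (≈.trans (pullˡ k∘i) assoc)))
              (≈.trans (≈.sym assoc) (≈.sym (pullˡ w∘m)))

  ∨-∧-isDistributiveLattice : IsDistributiveLattice _≡ₘ_ _≤ₘ_ _∨_ _∧_
  ∨-∧-isDistributiveLattice = record
    { isLattice = record
      { isPartialOrder = SymInterior.isPartialOrder ≤ₘ-refl ≤ₘ-trans
      ; supremum       = ∨-supremum
      ; infimum        = ∧-infimum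
      }
    -- The reverse inequality holds in every lattice, by the universal properties alone.
    ; ∧-distribˡ-∨ = λ x y z → ∧-distribˡ-∨-≤ₘ x y z , ∨-least
        (∧-greatest (∧-lowerˡ x y) (≤ₘ-trans (∧-lowerʳ x y) (proj₁ (∨-supremum y z))))
        (∧-greatest (∧-lowerˡ x z) (≤ₘ-trans (∧-lowerʳ x z) (proj₁ (proj₂ (∨-supremum y z)))))
    }
    where
    ∧-lowerˡ : ∀ x y → x ∧ y ≤ₘ x
    ∧-lowerˡ x y = proj₁ (∧-infimum x y)

    ∧-lowerʳ : ∀ x y → x ∧ y ≤ₘ y
    ∧-lowerʳ x y = proj₁ (proj₂ (∧-infimum x y))

    ∧-greatest : ∀ {x y z} → z ≤ₘ x → z ≤ₘ y → z ≤ₘ x ∧ y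
    ∧-greatest = proj₂ (proj₂ (∧-infimum _ _)) _

    ∨-least : ∀ {x y z} → x ≤ₘ z → y ≤ₘ z → x ∨ y ≤ₘ z
    ∨-least = proj₂ (proj₂ (∨-supremum _ _)) _

theorem18 : ∀ {o ℓ e p s c : Level} (α : Set c) (M : ManyOneCategoryExtension o ℓ e p s α) →
    Fin 2 ↣ α →
    let open ManyOneCategoryExtension M in
    ∃₂ λ (_∨_ _∧_ : Morphism → Morphism → Morphism) →
    IsDistributiveLattice _≡ₘ_ _≤ₘ_ _∨_ _∧_
theorem18 α M 2≤α = _∨_ , _∧_ , ∨-∧-isDistributiveLattice
  where open ManyOneProperties M 2≤α
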